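{- Let $\mathbf u$ be an infinite word over a finite alphabet whose language is closed under reversal. Suppose that both the defect $D(\mathbf u)$ and the sum $\sum_{n=0}^{+\infty}T_{\mathbf u}(n)$ are finite. Then $$2D(\mathbf u)=\sum_{n=0}^{+\infty}T_{\mathbf u}(n).$$
   Context: For a finite word $w=w_0\cdots w_{n-1}$ its reversal is $\overline{w}=w_{n-1}\cdots w_0$; $w$ is a palindrome if $w=\overline{w}$ (the empty word is a palindrome). The language $\mathcal L(\mathbf u)$ of an infinite word $\mathbf u$ is the set of its finite factors, $\mathcal L_n(\mathbf u)$ those of length $n$; the language is closed under reversal if $w\in\mathcal L(\mathbf u)$ implies $\overline{w}\in\mathcal L(\mathbf u)$. The defect of a finite word $w$ is $D(w)=|w|+1-(\text{number of distinct palindromic factors of } w, \text{ including the empty word})$. The defect of an infinite word is $D(\mathbf u)=\sup\{D(w): w \text{ a prefix of } \mathbf u\}$ (possibly $+\infty$). The factor complexity is $\mathcal C_{\mathbf u}(n)=\#\mathcal L_n(\mathbf u)$, the palindromic complexity $\mathcal P_{\mathbf u}(n)$ is the number of palindromes in $\mathcal L_n(\mathbf u)$, and $T_{\mathbf u}(n)=\mathcal C_{\mathbf u}(n+1)-\mathcal C_{\mathbf u}(n)+2-\mathcal P_{\mathbf u}(n+1)-\mathcal P_{\mathbf u}(n)$. -}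

module Defs where

open import Data.Nat using (ℕ; zero; suc; _+_; _∸_)
open import Data.Fin using (Fin)
import Data.Fin as Fin
open import Data.List using (List; []; _∷_; length; map; concatMap; upTo; applyUpTo; take; drop; reverse; filter; deduplicate)
open import Data.List.Properties using (≡-dec)
open import Data.List.Membership.Propositional using (_∈_)
open import Data.List.Relation.Unary.Unique.Propositional using (Unique)
open import Data.Integer using (ℤ; +_; _-_) renaming (_+_ to _+ℤ_)
open import Data.Product using (Σ; ∃; ∃-syntax; _×_)
open import Function.Bundles using (_⇔_)
open import Relation.Binary.PropositionalEquality using (_≡_)
open import Relation.Nullary using (Dec)

Word : ℕ → Set
Word k = ℕ → Fin k

FWord : ℕ → Set
FWord k = List (Fin k)

_≟w_ : ∀ {k} (v w : FWord k) → Dec (v ≡ w)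
_≟w_ = ≡-dec Fin._≟_

factorAt : ∀ {k} → Word k → ℕ → ℕ → FWord k
factorAt u i n = applyUpTo (λ j → u (i + j)) n

prefix : ∀ {k} → Word k → ℕ → FWord k
prefix u n = factorAt u 0 n

InLang : ∀ {k} → Word k → FWord k → Set
InLang u w = ∃[ i ] factorAt u i (length w) ≡ w

InLangN : ∀ {k} → Word k → ℕ → FWord k → Set
InLangN u n w = (length w ≡ n) × InLang u w

IsPalindrome : ∀ {k} → FWord k → Set
IsPalindrome w = w ≡ reverse w

ClosedUnderReversal : ∀ {k} → Word k → Set
ClosedUnderReversal u = ∀ w → InLang u w → InLang u (reverse w)

IsCard : ∀ {k} → (FWord k → Set) → ℕ → Set
IsCard {k} P c = Σ (List (FWord k)) λ xs → Unique xs × (length xs ≡ c) × (∀ w → (w ∈ xs) ⇔ P w)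

IsFactorComplexity : ∀ {k} → Word k → (ℕ → ℕ) → Set
IsFactorComplexity u C = ∀ n → IsCard (InLangN u n) (C n)

IsPalComplexity : ∀ {k} → Word k → (ℕ → ℕ) → Set
IsPalComplexity u P = ∀ n → IsCard (λ w → InLangN u n w × IsPalindrome w) (P n)

T : (ℕ → ℕ) → (ℕ → ℕ) → ℕ → ℤ
T C P n = + C (suc n) - + C n +ℤ + 2 - + P (suc n) - + P n

factorsF : ∀ {k} → FWord k → List (FWord k)
factorsF w = concatMap (λ i → map (λ l → take l (drop i w)) (upTo (suc (length w ∸ i)))) (upTo (suc (length w)))

palFactors : ∀ {k} → FWord k → List (FWord k)
palFactors w = filter (λ v → v ≟w reverse v) (deduplicate _≟w_ (factorsF w))

defectF : ∀ {k} → FWord k → ℤ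
defectF w = + (suc (length w)) - + length (palFactors w)

-- d is the supremum of D(prefix) over all prefixes and is attained (= D(u) finite)
IsDefect : ∀ {k} → Word k → ℤ → Set
IsDefect u d = (∀ n → defectF (prefix u n) Data.Integer.≤ d) × (∃[ n ] defectF (prefix u n) ≡ d)

sumBelow : (ℕ → ℤ) → ℕ → ℤ
sumBelow f zero = + 0
sumBelow f (suc N) = sumBelow f N +ℤ f N

{-# OPTIONS --safe #-}
module Submission where

-- Let n₀ be a length at which the defect is attained.  Each letter appended to
-- a prefix of u creates at most one new palindrome, hence exactly one beyond
-- length n₀.  Fix L > n₀, let s be the palindrome created at length M + 1 ≥ L and
-- f the suffix of length L there.  If |s| ≤ L, then s is a suffix of f and a
-- prefix of reverse f, so neither of these occurred before; if |s| > L, then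
-- reverse f is a prefix of s, so it did.  Thus palindromes of length ≤ L and
-- classes {f , reverse f} of length L appear simultaneously, and on a prefix
-- containing all factors of length L this gives, with #Pal(m) the number of
-- palindromes in the prefix of length m,
--   2 Σ_{n ≤ L} P(n) = C(L) + P(L) + 2 #Pal(L − 1),   #Pal(L − 1) = L − D(u),
-- which is Σ_{n < L} T(n) = 2 D(u) after telescoping.

open import Defs
open import Data.Nat using (ℕ; zero; suc; _+_; _∸_; _≤_; _<_; _≥_; _⊔_; z≤n; s≤s; s≤s⁻¹; _≤′_; ≤′-refl; ≤′-step)
import Data.Nat as ℕ
open import Data.Nat.Properties
open import Data.Nat.Tactic.RingSolver using (solve-∀)
open import Data.Integer using (ℤ; +_; _*_)
import Data.Integer as ℤ
import Data.Integer.Properties as ℤₚ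
import Data.Integer.Tactic.RingSolver as ℤ-Solver
open import Algebra.Properties.AbelianGroup ℤₚ.+-0-abelianGroup using () renaming (∙-cancelˡ to ℤ-+-cancelˡ)
open import Data.List using (List; []; _∷_; _++_; length; map; take; drop; reverse; applyUpTo; upTo)
open import Data.List.Properties
open import Data.List.Membership.Propositional using (_∈_; find)
import Data.List.Membership.DecPropositional as DecMembership
open import Data.List.Membership.Propositional.Properties using (∈-∃++; ∈-++⁺ˡ; ∈-++⁺ʳ; ∈-++⁻; ∈-map⁺; ∈-map⁻; ∈-concat⁺′; ∈-concat⁻′; ∈-upTo⁺; ∈-upTo⁻; ∈-filter⁺; ∈-filter⁻; ∈-deduplicate⁺; ∈-deduplicate⁻)
open import Data.List.Relation.Binary.Subset.Propositional using (_⊆_)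
open import Data.List.Relation.Unary.All using (All; []; _∷_; all?)
import Data.List.Relation.Unary.All as All
open import Data.List.Relation.Unary.All.Properties using (¬Any⇒All¬; ¬All⇒Any¬)
open import Data.List.Relation.Unary.Any using (here; there)
open import Data.List.Relation.Unary.AllPairs using ([]; _∷_)
open import Data.List.Relation.Unary.Unique.Propositional using (Unique)
import Data.List.Relation.Unary.Unique.Propositional.Properties as Unique
import Data.List.Relation.Unary.Unique.DecPropositional.Properties as DecUnique
open import Data.Product using (∃-syntax; _×_; _,_; proj₁; proj₂)
open import Data.Sum using (_⊎_; inj₁; inj₂)
open import Function using (_∘_; id)
open import Function.Bundles using (mk⇔; Equivalence)
open import Relation.Binary.PropositionalEquality using (_≡_; refl; sym; trans; cong; cong₂; subst; module ≡-Reasoning)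
open import Relation.Binary.Definitions using (tri<; tri≈; tri>)
open import Relation.Nullary.Decidable using (map′)
open import Relation.Nullary using (¬_; Dec; yes; no; contradiction)
open Equivalence using (to; from)

-- Cardinalities

unique-⊆⇒length-≤ : ∀ {A : Set} {xs ys : List A} → Unique xs → xs ⊆ ys → length xs ≤ length ys
unique-⊆⇒length-≤ {xs = []} _ _ = z≤n
unique-⊆⇒length-≤ {xs = x ∷ xs} (x∉xs ∷ uxs) xs⊆ys with ∈-∃++ (xs⊆ys (here refl))
... | as , bs , refl = begin
  suc (length xs)             ≤⟨ s≤s (unique-⊆⇒length-≤ uxs xs⊆as++bs) ⟩
  suc (length (as ++ bs))     ≡⟨ cong suc (length-++ as) ⟩
  suc (length as + length bs) ≡⟨ sym (+-suc (length as) (length bs)) ⟩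
  length as + suc (length bs) ≡⟨ sym (length-++ as) ⟩
  length (as ++ x ∷ bs)       ∎
  where
  open ≤-Reasoning
  xs⊆as++bs : xs ⊆ as ++ bs
  xs⊆as++bs z∈xs with ∈-++⁻ as (xs⊆ys (there z∈xs))
  ... | inj₁ z∈as           = ∈-++⁺ˡ z∈as
  ... | inj₂ (here refl)    = contradiction refl (All.lookup x∉xs z∈xs)
  ... | inj₂ (there z∈bs)   = ∈-++⁺ʳ as z∈bs

module _ {k : ℕ} where

  card-mono : ∀ {P Q : FWord k → Set} {m n} → IsCard P m → IsCard Q n → (∀ w → P w → Q w) → m ≤ n
  card-mono (xs , uxs , refl , P⇔) (ys , _ , refl , Q⇔) P⇒Q =
    unique-⊆⇒length-≤ uxs λ {w} w∈xs → from (Q⇔ w) (P⇒Q w (to (P⇔ w) w∈xs))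

  card-unique : ∀ {P Q : FWord k → Set} {m n} → IsCard P m → IsCard Q n → (∀ w → P w → Q w) → (∀ w → Q w → P w) → m ≡ n
  card-unique cP cQ P⇒Q Q⇒P = ≤-antisym (card-mono cP cQ P⇒Q) (card-mono cQ cP Q⇒P)

  card-resp : ∀ {P Q : FWord k → Set} {n} → (∀ w → P w → Q w) → (∀ w → Q w → P w) → IsCard P n → IsCard Q n
  card-resp P⇒Q Q⇒P (xs , uxs , eq , P⇔) =
    xs , uxs , eq , λ w → mk⇔ (P⇒Q w ∘ to (P⇔ w)) (from (P⇔ w) ∘ Q⇒P w)

  card-empty : ∀ {P : FWord k → Set} → (∀ w → ¬ P w) → IsCard P 0
  card-empty ¬P = [] , [] , refl , λ w → mk⇔ (λ ()) (λ p → contradiction p (¬P w))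

  card-insert : ∀ {P Q : FWord k → Set} {n} (v : FWord k) → ¬ P v → Q v →
    (∀ w → P w → Q w) → (∀ w → Q w → P w ⊎ w ≡ v) → IsCard P n → IsCard Q (suc n)
  card-insert {P} {Q} v ¬Pv Qv P⇒Q Q⇒ (xs , uxs , eq , P⇔) =
    v ∷ xs , ¬Any⇒All¬ xs (¬Pv ∘ to (P⇔ v)) ∷ uxs , cong suc eq , λ w → mk⇔ (fwd w) (bwd w)
    where
    fwd : ∀ w → w ∈ v ∷ xs → Q w
    fwd w (here refl)  = Qv
    fwd w (there w∈xs) = P⇒Q w (to (P⇔ w) w∈xs)
    bwd : ∀ w → Q w → w ∈ v ∷ xs
    bwd w q with Q⇒ w q
    ... | inj₁ p   = there (from (P⇔ w) p)
    ... | inj₂ w≡v = here w≡v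

  card-⊎ : ∀ {P Q : FWord k → Set} {m n} → (∀ w → P w → ¬ Q w) →
    IsCard P m → IsCard Q n → IsCard (λ w → P w ⊎ Q w) (m + n)
  card-⊎ {P} {Q} disj (xs , uxs , refl , P⇔) (ys , uys , refl , Q⇔) =
    xs ++ ys ,
    Unique.++⁺ uxs uys (λ {w} (w∈xs , w∈ys) → disj w (to (P⇔ w) w∈xs) (to (Q⇔ w) w∈ys)) ,
    length-++ xs ,
    λ w → mk⇔ (fwd w) (bwd w)
    where
    fwd : ∀ w → w ∈ xs ++ ys → P w ⊎ Q w
    fwd w w∈ with ∈-++⁻ xs w∈
    ... | inj₁ w∈xs = inj₁ (to (P⇔ w) w∈xs)
    ... | inj₂ w∈ys = inj₂ (to (Q⇔ w) w∈ys)
    bwd : ∀ w → P w ⊎ Q w → w ∈ xs ++ ys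
    bwd w (inj₁ p) = ∈-++⁺ˡ (from (P⇔ w) p)
    bwd w (inj₂ q) = ∈-++⁺ʳ xs (from (Q⇔ w) q)

-- Factors

++-injective : ∀ {A : Set} (xs xs′ : List A) {ys ys′} → length xs ≡ length xs′ →
  xs ++ ys ≡ xs′ ++ ys′ → xs ≡ xs′ × ys ≡ ys′
++-injective []       []         _  eq = refl , eq
++-injective (x ∷ xs) (x′ ∷ xs′) le eq with ∷-injective eq
... | refl , eq′ with ++-injective xs xs′ (suc-injective le) eq′
... | refl , ys≡ = refl , ys≡

take-length-++ : ∀ {A : Set} (xs ys : List A) → take (length xs) (xs ++ ys) ≡ xs
take-length-++ []       ys = refl
take-length-++ (x ∷ xs) ys = cong (x ∷_) (take-length-++ xs ys)

drop-length-++ : ∀ {A : Set} (xs ys : List A) → drop (length xs) (xs ++ ys) ≡ ys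
drop-length-++ []       ys = refl
drop-length-++ (x ∷ xs) ys = drop-length-++ xs ys

applyUpTo-cong : ∀ {A : Set} {f g : ℕ → A} → (∀ j → f j ≡ g j) → ∀ n → applyUpTo f n ≡ applyUpTo g n
applyUpTo-cong f≗g zero    = refl
applyUpTo-cong f≗g (suc n) = cong₂ _∷_ (f≗g 0) (applyUpTo-cong (f≗g ∘ suc) n)

applyUpTo-+ : ∀ {A : Set} (f : ℕ → A) m n → applyUpTo f (m + n) ≡ applyUpTo f m ++ applyUpTo (λ j → f (m + j)) n
applyUpTo-+ f zero    n = refl
applyUpTo-+ f (suc m) n = cong (f 0 ∷_) (applyUpTo-+ (f ∘ suc) m n)

module _ {k : ℕ} (u : Word k) where

  length-factorAt : ∀ i n → length (factorAt u i n) ≡ n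
  length-factorAt i n = length-applyUpTo _ n

  factorAt-+ : ∀ i m n → factorAt u i (m + n) ≡ factorAt u i m ++ factorAt u (i + m) n
  factorAt-+ i m n = trans (applyUpTo-+ _ m n)
    (cong (factorAt u i m ++_) (applyUpTo-cong (λ j → cong u (sym (+-assoc i m j))) n))

  factorAt-suffix : ∀ i j m n → factorAt u i (m + n) ≡ factorAt u j (m + n) →
    factorAt u (i + m) n ≡ factorAt u (j + m) n
  factorAt-suffix i j m n eq = proj₂ (++-injective (factorAt u i m) (factorAt u j m)
    (trans (length-factorAt i m) (sym (length-factorAt j m)))
    (trans (sym (factorAt-+ i m n)) (trans eq (factorAt-+ j m n))))

  -- Reversal exchanges suffixes with prefixes: the reversal of a word begins with the reversal of
  -- its last `n` letters.
  factorAt-mirror : ∀ i j m n → factorAt u j (m + n) ≡ reverse (factorAt u i (m + n)) →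
    factorAt u j n ≡ reverse (factorAt u (i + m) n)
  factorAt-mirror i j m n eq = proj₁ (++-injective (factorAt u j n) (reverse (factorAt u (i + m) n))
    (trans (length-factorAt j n) (sym (trans (length-reverse (factorAt u (i + m) n)) (length-factorAt (i + m) n))))
    (begin
      factorAt u j n ++ factorAt u (j + n) m                         ≡⟨ factorAt-+ j n m ⟨
      factorAt u j (n + m)                                           ≡⟨ cong (factorAt u j) (+-comm n m) ⟩
      factorAt u j (m + n)                                           ≡⟨ eq ⟩
      reverse (factorAt u i (m + n))                                 ≡⟨ cong reverse (factorAt-+ i m n) ⟩
      reverse (factorAt u i m ++ factorAt u (i + m) n)               ≡⟨ reverse-++ (factorAt u i m) _ ⟩
      reverse (factorAt u (i + m) n) ++ reverse (factorAt u i m)     ∎))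
    where open ≡-Reasoning

  -- Occurrence in `prefix u M`, expressed by positions in `u` rather than by membership in
  -- `factorsF`, so that appending a letter to the prefix merely relaxes a bound. `∈-factorsF⇒Occ`
  -- and `Occ⇒∈-factorsF` identify the two views.
  Occ : ℕ → FWord k → Set
  Occ M w = ∃[ i ] ∃[ l ] (i + l ≤ M × w ≡ factorAt u i l)

  Occ-mono : ∀ {M M′ w} → M ≤ M′ → Occ M w → Occ M′ w
  Occ-mono M≤M′ (i , l , le , eq) = i , l , ≤-trans le M≤M′ , eq

  Occ⇒length≤ : ∀ {M w} → Occ M w → length w ≤ M
  Occ⇒length≤ {M} (i , l , le , refl) = subst (_≤ M) (sym (length-factorAt i l)) (≤-trans (m≤n+m l i) le)

  Occ⇒InLang : ∀ {M w} → Occ M w → InLang u w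
  Occ⇒InLang (i , l , _ , refl) = i , cong (factorAt u i) (length-factorAt i l)

  Occ-at : ∀ {M n w} → length w ≡ n → Occ M w → ∃[ i ] (i + n ≤ M × w ≡ factorAt u i n)
  Occ-at refl (i , l , le , refl) rewrite length-factorAt i l = i , le , refl

  -- An occurrence that does not fit into the first `M` letters must end at the last letter, so that
  -- `w` is a suffix of the longer prefix.
  Occ-suc : ∀ {M w} → Occ (suc M) w → Occ M w ⊎ (∃[ i ] ∃[ l ] (i + l ≡ suc M × w ≡ factorAt u i l))
  Occ-suc (i , l , le , eq) with m≤n⇒m<n∨m≡n le
  ... | inj₁ lt  = inj₁ (i , l , s≤s⁻¹ lt , eq)
  ... | inj₂ i+l = inj₂ (i , l , i+l , eq)

  take-drop-prefix : ∀ M i l → i + l ≤ M → take l (drop i (prefix u M)) ≡ factorAt u i l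
  take-drop-prefix M i l le with m≤n⇒∃[o]m+o≡n le
  ... | r , refl = begin
    take l (drop i (prefix u (i + l + r)))
      ≡⟨ cong (λ n → take l (drop i (prefix u n))) (+-assoc i l r) ⟩
    take l (drop i (prefix u (i + (l + r))))
      ≡⟨ cong (take l ∘ drop i) (factorAt-+ 0 i (l + r)) ⟩
    take l (drop i (prefix u i ++ factorAt u i (l + r)))
      ≡⟨ cong (λ n → take l (drop n (prefix u i ++ factorAt u i (l + r)))) (length-factorAt 0 i) ⟨
    take l (drop (length (prefix u i)) (prefix u i ++ factorAt u i (l + r)))
      ≡⟨ cong (take l) (drop-length-++ (prefix u i) _) ⟩
    take l (factorAt u i (l + r))
      ≡⟨ cong (take l) (factorAt-+ i l r) ⟩
    take l (factorAt u i l ++ factorAt u (i + l) r)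
      ≡⟨ cong (λ n → take n (factorAt u i l ++ factorAt u (i + l) r)) (length-factorAt i l) ⟨
    take (length (factorAt u i l)) (factorAt u i l ++ factorAt u (i + l) r)
      ≡⟨ take-length-++ (factorAt u i l) _ ⟩
    factorAt u i l ∎
    where open ≡-Reasoning

  -- The inner list of `factorsF`, named so that the membership lemmas for `map` and `concat` can
  -- refer to it.
  factorsFrom : FWord k → ℕ → List (FWord k)
  factorsFrom w i = map (λ l → take l (drop i w)) (upTo (suc (length w ∸ i)))

  ∈-factorsF⇒Occ : ∀ M {w} → w ∈ factorsF (prefix u M) → Occ M w
  ∈-factorsF⇒Occ M w∈ with ∈-concat⁻′ (map (factorsFrom (prefix u M)) (upTo (suc (length (prefix u M))))) w∈
  ... | ws , w∈ws , ws∈ with ∈-map⁻ (factorsFrom (prefix u M)) {xs = upTo (suc (length (prefix u M)))} ws∈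
  ... | i , i∈ , refl with ∈-map⁻ (λ l → take l (drop i (prefix u M))) w∈ws
  ... | l , l∈ , refl = i , l , i+l≤M , take-drop-prefix M i l i+l≤M
    where
    i≤M : i ≤ M
    i≤M = subst (i ≤_) (length-factorAt 0 M) (s≤s⁻¹ (∈-upTo⁻ i∈))
    l≤M∸i : l ≤ M ∸ i
    l≤M∸i = subst (λ n → l ≤ n ∸ i) (length-factorAt 0 M) (s≤s⁻¹ (∈-upTo⁻ l∈))
    i+l≤M : i + l ≤ M
    i+l≤M = ≤-trans (+-monoʳ-≤ i l≤M∸i) (≤-reflexive (m+[n∸m]≡n i≤M))

  Occ⇒∈-factorsF : ∀ M {w} → Occ M w → w ∈ factorsF (prefix u M)
  Occ⇒∈-factorsF M (i , l , i+l≤M , refl) =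
    ∈-concat⁺′ (subst (_∈ _) (take-drop-prefix M i l i+l≤M) (∈-map⁺ (λ l → take l (drop i (prefix u M))) (∈-upTo⁺ (s≤s l≤))))
               (∈-map⁺ (factorsFrom (prefix u M)) (∈-upTo⁺ (s≤s i≤)))
    where
    i≤ : i ≤ length (prefix u M)
    i≤ = subst (i ≤_) (sym (length-factorAt 0 M)) (≤-trans (m≤m+n i l) i+l≤M)
    l≤ : l ≤ length (prefix u M) ∸ i
    l≤ = subst (λ n → l ≤ n ∸ i) (sym (length-factorAt 0 M))
           (subst (_≤ M ∸ i) (m+n∸m≡n i l) (∸-monoˡ-≤ i i+l≤M))

  -- Palindromes in prefixes

  PalOcc : ℕ → FWord k → Set
  PalOcc M w = Occ M w × IsPalindrome w

  #pal : ℕ → ℕ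
  #pal M = length (palFactors (prefix u M))

  palFactors-card : ∀ M → IsCard (PalOcc M) (#pal M)
  palFactors-card M = palFactors p , Unique.filter⁺ pal? (DecUnique.deduplicate-! _≟w_ (factorsF p)) , refl ,
    λ w → mk⇔ fwd (λ (occ , pal) → ∈-filter⁺ pal? (∈-deduplicate⁺ _≟w_ (Occ⇒∈-factorsF M occ)) pal)
    where
    p = prefix u M
    pal? = λ (v : FWord k) → v ≟w reverse v
    fwd : ∀ {w} → w ∈ palFactors p → PalOcc M w
    fwd w∈ with ∈-filter⁻ pal? w∈
    ... | w∈′ , pal = ∈-factorsF⇒Occ M (∈-deduplicate⁻ _≟w_ _ w∈′) , pal

  -- The shorter of two palindromic suffixes is also a prefix of the longer one.
  shorter-palindromic-suffix-recurs : ∀ {M s t i j l m} → i + l ≡ suc M → j + m ≡ suc M → l < m →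
    s ≡ factorAt u i l → t ≡ factorAt u j m → IsPalindrome s → IsPalindrome t → Occ M s
  shorter-palindromic-suffix-recurs {M} {i = i} {j} {l} {m} i+l j+m l<m refl refl ps pt
    with m≤n⇒∃[o]m+o≡n l<m
  ... | a , refl = j , l , j+l≤M , s≡
    where
    i≡ : i ≡ j + suc a
    i≡ = +-cancelʳ-≡ l i (j + suc a) (trans i+l (trans (sym j+m) (regroup j a l)))
      where
      regroup : ∀ j a l → j + (suc l + a) ≡ j + suc a + l
      regroup = solve-∀
    j+l≤M : j + l ≤ M
    j+l≤M = s≤s⁻¹ (≤-trans (≤-trans (m≤m+n (suc (j + l)) a) (≤-reflexive (regroup j l a))) (≤-reflexive j+m))
      where
      regroup : ∀ j l a → suc (j + l) + a ≡ j + (suc l + a)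
      regroup = solve-∀
    m≡ : suc l + a ≡ suc a + l
    m≡ = cong suc (+-comm l a)
    s≡ : factorAt u i l ≡ factorAt u j l
    s≡ = trans ps (trans (cong (λ n → reverse (factorAt u n l)) i≡)
      (sym (factorAt-mirror j j (suc a) l
        (subst (λ n → factorAt u j n ≡ reverse (factorAt u j n)) m≡ pt))))

  -- Two new palindromes are both suffixes of the prefix. If their lengths differed, the shorter
  -- would already occur at the start of the longer; with equal lengths they are the same suffix.
  new-palindrome-unique : ∀ {M s t} → PalOcc (suc M) s → ¬ Occ M s → PalOcc (suc M) t → ¬ Occ M t → s ≡ t
  new-palindrome-unique (os , ps) ¬os (ot , pt) ¬ot with Occ-suc os | Occ-suc ot
  ... | inj₁ os′ | _ = contradiction os′ ¬os
  ... | _ | inj₁ ot′ = contradiction ot′ ¬ot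
  ... | inj₂ (i , l , i+l , s≡) | inj₂ (j , m , j+m , t≡) with <-cmp l m
  ... | tri< l<m _ _ = contradiction (shorter-palindromic-suffix-recurs i+l j+m l<m s≡ t≡ ps pt) ¬os
  ... | tri> _ _ m<l = contradiction (shorter-palindromic-suffix-recurs j+m i+l m<l t≡ s≡ pt ps) ¬ot
  ... | tri≈ _ refl _ = trans s≡ (trans (cong (λ n → factorAt u n l) (+-cancelʳ-≡ l i j (trans i+l (sym j+m)))) (sym t≡))

  Occ? : ∀ M w → Dec (Occ M w)
  Occ? M w = map′ (∈-factorsF⇒Occ M) (Occ⇒∈-factorsF M) (w ∈? factorsF (prefix u M))
    where open DecMembership (_≟w_ {k}) using (_∈?_)

  NewPalindrome : ℕ → Set
  NewPalindrome M = ∃[ s ] (PalOcc (suc M) s × ¬ Occ M s)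

  -- The palindromes of the longer prefix form a finite list and `Occ M` is decidable, so a search
  -- settles the alternative constructively.
  newPalindrome? : ∀ M → (∀ w → PalOcc (suc M) w → Occ M w) ⊎ NewPalindrome M
  newPalindrome? M with palFactors-card (suc M)
  ... | xs , _ , _ , xs⇔ with all? (Occ? M) xs
  ... | yes all = inj₁ λ w p → All.lookup all (from (xs⇔ w) p)
  ... | no ¬all with find (¬All⇒Any¬ (Occ? M) xs ¬all)
  ... | s , s∈xs , ¬occ = inj₂ (s , to (xs⇔ s) s∈xs , ¬occ)

  PalOcc-suc : ∀ {M s} → PalOcc (suc M) s → ¬ Occ M s → ∀ w → PalOcc (suc M) w → PalOcc M w ⊎ w ≡ s
  PalOcc-suc {M} ps ¬os w pw with Occ? M w
  ... | yes ow = inj₁ (ow , proj₂ pw)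
  ... | no ¬ow = inj₂ (new-palindrome-unique pw ¬ow ps ¬os)

  PalOcc-step : ∀ {M} w → PalOcc M w → PalOcc (suc M) w
  PalOcc-step w (ow , pw) = Occ-mono (n≤1+n _) ow , pw

  -- A consequence of `new-palindrome-unique`; equivalently, the defect of a prefix never decreases
  -- as the prefix grows.
  #pal-suc-≤ : ∀ M → #pal (suc M) ≤ suc (#pal M)
  #pal-suc-≤ M with newPalindrome? M
  ... | inj₁ none = m≤n⇒m≤1+n (card-mono (palFactors-card (suc M)) (palFactors-card M) λ w p → none w p , proj₂ p)
  ... | inj₂ (s , ps , ¬os) = ≤-reflexive (card-unique (palFactors-card (suc M))
    (card-insert s (¬os ∘ proj₁) ps PalOcc-step (PalOcc-suc ps ¬os) (palFactors-card M)) (λ _ → id) (λ _ → id))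

  #pal-<⇒new : ∀ M → #pal M < #pal (suc M) → NewPalindrome M
  #pal-<⇒new M lt with newPalindrome? M
  ... | inj₂ new  = new
  ... | inj₁ none = contradiction
    (card-mono (palFactors-card (suc M)) (palFactors-card M) λ w p → none w p , proj₂ p) (<⇒≱ lt)

  -- Prefixes beyond the length at which the defect is attained

  module _ {d : ℤ} (isDefect : IsDefect u d) where

    defect-attained : ℕ
    defect-attained = proj₁ (proj₂ isDefect)

    -- Once the defect of a prefix equals `d` it stays there: it cannot fall, by `#pal-suc-≤`
    -- (`upper`), and it cannot exceed the supremum `d` (`lower`).
    #pal-defect : ∀ {M} → defect-attained ≤′ M → d ℤ.+ + #pal M ≡ + suc M
    #pal-defect {M} ≤′-refl = trans (cong (ℤ._+ + #pal M) (sym (proj₂ (proj₂ isDefect))))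
      (trans (cancel (+ suc (length (prefix u M))) (+ #pal M)) (cong (+_ ∘ suc) (length-factorAt 0 M)))
      where
      cancel : ∀ x y → x ℤ.- y ℤ.+ y ≡ x
      cancel = ℤ-Solver.solve-∀
    #pal-defect {suc M} (≤′-step le) = ℤₚ.≤-antisym upper lower
      where
      open ℤₚ.≤-Reasoning
      q q′ : ℤ
      q  = + #pal M
      q′ = + #pal (suc M)
      cancel : ∀ x y → x ℤ.- y ℤ.+ y ≡ x
      cancel = ℤ-Solver.solve-∀
      shift : ∀ x y → x ℤ.+ (+ 1 ℤ.+ y) ≡ + 1 ℤ.+ (x ℤ.+ y)
      shift = ℤ-Solver.solve-∀
      upper : d ℤ.+ q′ ℤ.≤ + suc (suc M)
      upper = begin
        d ℤ.+ q′                ≤⟨ ℤₚ.+-monoʳ-≤ d (ℤ.+≤+ (#pal-suc-≤ M)) ⟩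
        d ℤ.+ (+ 1 ℤ.+ q)       ≡⟨ shift d q ⟩
        + 1 ℤ.+ (d ℤ.+ q)       ≡⟨ cong ℤ.suc (#pal-defect le) ⟩
        + suc (suc M)           ∎
      lower : + suc (suc M) ℤ.≤ d ℤ.+ q′
      lower = begin
        + suc (suc M)                                  ≡⟨ cong (+_ ∘ suc) (length-factorAt 0 (suc M)) ⟨
        + suc (length (prefix u (suc M)))              ≡⟨ cancel _ q′ ⟨
        defectF (prefix u (suc M)) ℤ.+ q′              ≤⟨ ℤₚ.+-monoˡ-≤ q′ (proj₁ isDefect (suc M)) ⟩
        d ℤ.+ q′                                       ∎

    -- As the defect is constant from here on, the number of palindromes has to grow together with
    -- the length.
    new-palindrome : ∀ {M} → defect-attained ≤ M → NewPalindrome M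
    new-palindrome {M} le = #pal-<⇒new M (≤-reflexive (sym (ℤₚ.+-injective (ℤ-+-cancelˡ d _ _ (begin
      d ℤ.+ + #pal (suc M)          ≡⟨ #pal-defect (≤′-step (≤⇒≤′ le)) ⟩
      + 1 ℤ.+ + suc M               ≡⟨ cong ℤ.suc (#pal-defect (≤⇒≤′ le)) ⟨
      + 1 ℤ.+ (d ℤ.+ + #pal M)      ≡⟨ shift d (+ #pal M) ⟩
      d ℤ.+ + suc (#pal M)          ∎)))))
      where
      open ≡-Reasoning
      shift : ∀ x y → + 1 ℤ.+ (x ℤ.+ y) ≡ x ℤ.+ (+ 1 ℤ.+ y)
      shift = ℤ-Solver.solve-∀

  -- Short palindromes versus reversal classes of length `L`

  module _ (L : ℕ) where

    -- The set of factors of a prefix need not be closed under reversal even when the language of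
    -- `u` is; `ReversalClosure` adds the missing reversals, so that a class {w, `reverse w`} enters
    -- as a whole.
    ShortPal ReversalClosure PalL : ℕ → FWord k → Set
    ShortPal M w        = PalOcc M w × length w ≤ L
    ReversalClosure M w = length w ≡ L × (Occ M w ⊎ Occ M (reverse w))
    PalL M w            = length w ≡ L × PalOcc M w

    -- A class {w, `reverse w`} of two words contributes 2 to `b` and 0 to `e`, a palindrome
    -- contributes 1 to each. Hence `b + e` is twice the number of classes, and the equation says
    -- that `a` exceeds `q` by exactly that number.
    Invariant : ℕ → ℕ → Set
    Invariant q M = ∃[ a ] ∃[ b ] ∃[ e ]
      (IsCard (ShortPal M) a × IsCard (ReversalClosure M) b × IsCard (PalL M) e × 2 ℕ.* a ≡ b + e + 2 ℕ.* q)

    module Step {M j : ℕ} (j+L : j + L ≡ suc M) where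

      f : FWord k
      f = factorAt u j L

      |f| : length f ≡ L
      |f| = length-factorAt j L

      f-occ : Occ (suc M) f
      f-occ = j , L , ≤-reflexive j+L , refl

      -- A word of length `L` ending at the last letter has to start at `j`, so `f` is the only
      -- candidate for a new factor of this length.
      Occ-suc-L : ∀ {w} → length w ≡ L → Occ (suc M) w → Occ M w ⊎ w ≡ f
      Occ-suc-L lw ow with Occ-suc ow
      ... | inj₁ ow′ = inj₁ ow′
      ... | inj₂ (i , l , i+l , refl) with trans (sym (length-factorAt i l)) lw
      ... | refl = inj₂ (cong (λ n → factorAt u n l) (+-cancelʳ-≡ l i j (trans i+l (sym j+L))))

      ShortPal-step : ∀ w → ShortPal M w → ShortPal (suc M) w
      ShortPal-step w (p , le) = PalOcc-step w p , le

      ReversalClosure-step : ∀ w → ReversalClosure M w → ReversalClosure (suc M) w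
      ReversalClosure-step w (lw , inj₁ o) = lw , inj₁ (Occ-mono (n≤1+n _) o)
      ReversalClosure-step w (lw , inj₂ o) = lw , inj₂ (Occ-mono (n≤1+n _) o)

      PalL-step : ∀ w → PalL M w → PalL (suc M) w
      PalL-step w (lw , p) = lw , PalOcc-step w p

      ReversalClosure-suc : ∀ w → ReversalClosure (suc M) w → ReversalClosure M w ⊎ (w ≡ f ⊎ w ≡ reverse f)
      ReversalClosure-suc w (lw , inj₁ o) with Occ-suc-L lw o
      ... | inj₁ o′  = inj₁ (lw , inj₁ o′)
      ... | inj₂ w≡f = inj₂ (inj₁ w≡f)
      ReversalClosure-suc w (lw , inj₂ o) with Occ-suc-L (trans (length-reverse w) lw) o
      ... | inj₁ o′  = inj₁ (lw , inj₂ o′)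
      ... | inj₂ eq  = inj₂ (inj₂ (trans (sym (reverse-involutive w)) (cong reverse eq)))

      PalL-suc : ∀ w → PalL (suc M) w → PalL M w ⊎ w ≡ f
      PalL-suc w (lw , o , p) with Occ-suc-L lw o
      ... | inj₁ o′  = inj₁ (lw , o′ , p)
      ... | inj₂ w≡f = inj₂ w≡f

      module _ {s i l} (i+l : i + l ≡ suc M) (s≡ : s ≡ factorAt u i l) (ps : IsPalindrome s) (¬os : ¬ Occ M s) where

        occ-s : Occ (suc M) s
        occ-s = i , l , ≤-reflexive i+l , s≡

        |s| : length s ≡ l
        |s| = trans (cong length s≡) (length-factorAt i l)

        -- The case of a new palindrome `s` no longer than `L`: it is a suffix of `f`, preceded
        -- there by `a` letters.
        module Short {a} (a+l : a + l ≡ L) where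

          i≡ : i ≡ j + a
          i≡ = +-cancelʳ-≡ l i (j + a) (trans i+l (trans (sym j+L) (trans (cong (λ n → j + n) (sym a+l)) (sym (+-assoc j a l)))))

          s≡′ : s ≡ factorAt u (j + a) l
          s≡′ = trans s≡ (cong (λ n → factorAt u n l) i≡)

          -- An earlier occurrence of `f` would end in an earlier occurrence of `s`.
          f-new : ¬ Occ M f
          f-new o with Occ-at |f| o
          ... | i′ , le , eq = ¬os (i′ + a , l , ≤-trans (≤-reflexive i′+a+l) le ,
            trans s≡′ (factorAt-suffix j i′ a l (subst (λ n → factorAt u j n ≡ factorAt u i′ n) (sym a+l) eq)))
            where
            i′+a+l : i′ + a + l ≡ i′ + L
            i′+a+l = trans (+-assoc i′ a l) (cong (λ n → i′ + n) a+l)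

          -- Since `s` is a palindrome, `reverse f` begins with `s`, and an earlier occurrence of it
          -- would again give one of `s`.
          reverse-f-new : ¬ Occ M (reverse f)
          reverse-f-new o with Occ-at (trans (length-reverse f) |f|) o
          ... | i′ , le , eq = ¬os (i′ , l , ≤-trans (+-monoʳ-≤ i′ (subst (l ≤_) a+l (m≤n+m l a))) le ,
            trans ps (trans (cong reverse s≡′) (sym (factorAt-mirror j i′ a l
              (subst (λ n → factorAt u i′ n ≡ reverse (factorAt u j n)) (sym a+l) (sym eq))))))

          ¬closure-f : ¬ ReversalClosure M f
          ¬closure-f (_ , inj₁ o) = f-new o
          ¬closure-f (_ , inj₂ o) = reverse-f-new o

          ¬closure-reverse-f : ¬ ReversalClosure M (reverse f)
          ¬closure-reverse-f (_ , inj₁ o) = reverse-f-new o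
          ¬closure-reverse-f (_ , inj₂ o) = f-new (subst (Occ M) (reverse-involutive f) o)

          card-short : ∀ {n} → IsCard (ShortPal M) n → IsCard (ShortPal (suc M)) (suc n)
          card-short = card-insert s (¬os ∘ proj₁ ∘ proj₁)
            ((occ-s , ps) , subst (_≤ L) (sym |s|) (subst (l ≤_) a+l (m≤n+m l a)))
            ShortPal-step bwd
            where
            bwd : ∀ w → ShortPal (suc M) w → ShortPal M w ⊎ w ≡ s
            bwd w (p , le) with PalOcc-suc (occ-s , ps) ¬os w p
            ... | inj₁ p′  = inj₁ (p′ , le)
            ... | inj₂ w≡s = inj₂ w≡s

          -- The palindrome `s` adds 2 on the left. On the right the class of `f` is entirely new
          -- and adds 2 as well: one each to `b` and `e` if `f` is a palindrome, otherwise two to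
          -- `b`.
          step-short : ∀ {q} → Invariant q M → Invariant q (suc M)
          step-short {q} (a , b , e , ca , cb , ce , eq) with f ≟w reverse f
          ... | yes pf = suc a , suc b , suc e , card-short ca ,
            card-insert f ¬closure-f (|f| , inj₁ f-occ) ReversalClosure-step bwd cb ,
            card-insert f (f-new ∘ proj₁ ∘ proj₂) (|f| , f-occ , pf) PalL-step PalL-suc ce ,
            trans (*-suc 2 a) (trans (cong (λ n → 2 + n) eq) (regroup b e q))
            where
            regroup : ∀ b e q → 2 + (b + e + 2 ℕ.* q) ≡ suc b + suc e + 2 ℕ.* q
            regroup = solve-∀
            bwd : ∀ w → ReversalClosure (suc M) w → ReversalClosure M w ⊎ w ≡ f
            bwd w c with ReversalClosure-suc w c
            ... | inj₁ c′          = inj₁ c′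
            ... | inj₂ (inj₁ w≡f)  = inj₂ w≡f
            ... | inj₂ (inj₂ w≡rf) = inj₂ (trans w≡rf (sym pf))
          ... | no ¬pf = suc a , suc (suc b) , e , card-short ca ,
            card-insert (reverse f) ¬mid-rf (trans (length-reverse f) |f| , inj₂ (subst (Occ (suc M)) (sym (reverse-involutive f)) f-occ))
              mid⇒ bwd (card-insert f ¬closure-f (inj₂ refl) (λ _ → inj₁) (λ _ → id) cb) ,
            card-resp PalL-step bwdₚ ce ,
            trans (*-suc 2 a) (cong (λ n → 2 + n) eq)
            where
            -- `card-insert` adds one word at a time; this is the set after `f` and before
            -- `reverse f`.
            Mid : FWord k → Set
            Mid w = ReversalClosure M w ⊎ w ≡ f
            ¬mid-rf : ¬ Mid (reverse f)
            ¬mid-rf (inj₁ c)  = ¬closure-reverse-f c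
            ¬mid-rf (inj₂ eq) = ¬pf (sym eq)
            mid⇒ : ∀ w → Mid w → ReversalClosure (suc M) w
            mid⇒ w (inj₁ c)    = ReversalClosure-step w c
            mid⇒ w (inj₂ refl) = |f| , inj₁ f-occ
            bwd : ∀ w → ReversalClosure (suc M) w → Mid w ⊎ w ≡ reverse f
            bwd w c with ReversalClosure-suc w c
            ... | inj₁ c′          = inj₁ (inj₁ c′)
            ... | inj₂ (inj₁ w≡f)  = inj₁ (inj₂ w≡f)
            ... | inj₂ (inj₂ w≡rf) = inj₂ w≡rf
            bwdₚ : ∀ w → PalL (suc M) w → PalL M w
            bwdₚ w p with PalL-suc w p
            ... | inj₁ p′   = p′
            ... | inj₂ refl = contradiction (proj₂ (proj₂ p)) ¬pf

        -- The case of a new palindrome `s` longer than `L`: now `f` is a proper suffix of `s`,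
        -- preceded there by `suc a` letters.
        module Long {a} (a+L : suc a + L ≡ l) where

          j≡ : j ≡ i + suc a
          j≡ = +-cancelʳ-≡ L j (i + suc a) (trans j+L (trans (sym i+l) (trans (cong (λ n → i + n) (sym a+L)) (sym (+-assoc i (suc a) L)))))

          -- The palindrome `s` ends in `f`, hence begins with `reverse f`; this proper prefix of
          -- `s` stops before the last letter.
          reverse-f-occ : Occ M (reverse f)
          reverse-f-occ = i , L ,
            s≤s⁻¹ (≤-trans (≤-reflexive (sym (+-suc i L)))
              (≤-trans (+-monoʳ-≤ i (subst (suc L ≤_) a+L (s≤s (m≤n+m L a)))) (≤-reflexive i+l))) ,
            trans (cong (λ n → reverse (factorAt u n L)) j≡)
              (sym (factorAt-mirror i i (suc a) L (subst (λ n → factorAt u i n ≡ reverse (factorAt u i n)) (sym a+L)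
                (trans (sym s≡) (trans ps (cong reverse s≡))))))

          -- No count changes: `s` is too long to be counted, the class of `f` is already present by
          -- `reverse-f-occ`, and a palindromic `f` is `reverse f` itself.
          step-long : ∀ {q} → Invariant q M → Invariant q (suc M)
          step-long (a′ , b , e , ca , cb , ce , eq) = a′ , b , e ,
            card-resp ShortPal-step bwdₛ ca , card-resp ReversalClosure-step bwd cb , card-resp PalL-step bwdₚ ce , eq
            where
            bwdₛ : ∀ w → ShortPal (suc M) w → ShortPal M w
            bwdₛ w (p , le) with PalOcc-suc (occ-s , ps) ¬os w p
            ... | inj₁ p′   = p′ , le
            ... | inj₂ refl = contradiction (subst (_≤ L) |s| le) (<⇒≱ (subst (suc L ≤_) a+L (s≤s (m≤n+m L a))))
            bwd : ∀ w → ReversalClosure (suc M) w → ReversalClosure M w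
            bwd w c with ReversalClosure-suc w c
            ... | inj₁ c′           = c′
            ... | inj₂ (inj₁ refl)  = proj₁ c , inj₂ reverse-f-occ
            ... | inj₂ (inj₂ refl)  = proj₁ c , inj₁ reverse-f-occ
            bwdₚ : ∀ w → PalL (suc M) w → PalL M w
            bwdₚ w p with PalL-suc w p
            ... | inj₁ p′   = p′
            ... | inj₂ refl = proj₁ p , subst (Occ M) (sym (proj₂ (proj₂ p))) reverse-f-occ , proj₂ (proj₂ p)

    -- The new palindrome is a suffix, so one of the two cases applies. The bound `L ≤ suc M` lets
    -- `f` start at position `suc M ∸ L`.
    invariant-suc : ∀ {M q} → L ≤ suc M → NewPalindrome M → Invariant q M → Invariant q (suc M)
    invariant-suc {M} {q} L≤ (s , (os , ps) , ¬os) inv with Occ-suc os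
    ... | inj₁ os′ = contradiction os′ ¬os
    ... | inj₂ (i , l , i+l , s≡) with l ≤? L
    ... | yes l≤L = Step.Short.step-short (m∸n+n≡m L≤) i+l s≡ ps ¬os (m∸n+n≡m l≤L) {q} inv
    ... | no l≰L = Step.Long.step-long (m∸n+n≡m L≤) i+l s≡ ps ¬os a+L {q} inv
      where
      a+L : suc (l ∸ suc L) + L ≡ l
      a+L = trans (sym (+-suc (l ∸ suc L) L)) (m∸n+n≡m (≰⇒> l≰L))

  -- A prefix of length `L′` has no factor of length `suc L′`, and all its palindromes are short;
  -- this is where the value `#pal L′` of `q` comes from.
  invariant-start : ∀ L′ → Invariant (suc L′) (#pal L′) L′
  invariant-start L′ = #pal L′ , 0 , 0 ,
    card-resp (λ w p → p , m≤n⇒m≤1+n (Occ⇒length≤ (proj₁ p))) (λ w → proj₁) (palFactors-card L′) ,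
    card-empty ¬closure , card-empty (λ w (lw , o , _) → too-short lw (Occ⇒length≤ o)) , refl
    where
    too-short : ∀ {n} → n ≡ suc L′ → ¬ n ≤ L′
    too-short refl = <⇒≱ (n<1+n L′)
    ¬closure : ∀ w → ¬ ReversalClosure (suc L′) L′ w
    ¬closure w (lw , inj₁ o) = too-short lw (Occ⇒length≤ o)
    ¬closure w (lw , inj₂ o) = too-short (trans (length-reverse w) lw) (Occ⇒length≤ o)

  invariant : ∀ {d L′} (isDefect : IsDefect u d) → defect-attained isDefect ≤ L′ →
    ∀ {M} → L′ ≤′ M → Invariant (suc L′) (#pal L′) M
  invariant {L′ = L′} isDefect n₀≤L′ ≤′-refl = invariant-start L′
  invariant {L′ = L′} isDefect n₀≤L′ (≤′-step le) = invariant-suc (suc L′) {q = #pal L′} (s≤s (≤′⇒≤ le))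
    (new-palindrome isDefect (≤-trans n₀≤L′ (≤′⇒≤ le))) (invariant isDefect n₀≤L′ le)

  -- Prefixes containing all factors up to a given length

  InLang⇒Occ : ∀ {w} → InLang u w → ∃[ M ] Occ M w
  InLang⇒Occ {w} (i , eq) = i + length w , i , length w , ≤-refl , sym eq

  all-occ : ∀ {ws} → All (InLang u) ws → ∃[ M ] All (Occ M) ws
  all-occ []       = 0 , []
  all-occ (p ∷ ps) with InLang⇒Occ p | all-occ ps
  ... | m , o | n , os = m ⊔ n , Occ-mono (m≤m⊔n m n) o ∷ All.map (Occ-mono (m≤n⊔m m n)) os

  factorAt-prefix : ∀ i j m n → factorAt u i (m + n) ≡ factorAt u j (m + n) → factorAt u i m ≡ factorAt u j m
  factorAt-prefix i j m n eq = proj₁ (++-injective (factorAt u i m) (factorAt u j m)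
    (trans (length-factorAt i m) (sym (length-factorAt j m)))
    (trans (sym (factorAt-+ i m n)) (trans eq (factorAt-+ j m n))))

  -- Every factor of length at most L extends to the right to one of length L.
  exhausting-prefix : ∀ {L c} → IsCard (InLangN u L) c →
    ∃[ M ] (∀ {w} → length w ≤ L → InLang u w → Occ M w)
  exhausting-prefix {L} (xs , _ , _ , xs⇔) with all-occ (All.tabulate λ {w} w∈xs → proj₂ (to (xs⇔ w) w∈xs))
  ... | M , occ = M , λ {w} → go w
    where
    go : ∀ w → length w ≤ L → InLang u w → Occ M w
    go w |w|≤L (i , eq)
      with All.lookup occ (from (xs⇔ (factorAt u i L)) (length-factorAt i L , i , cong (factorAt u i) (length-factorAt i L)))
         | m≤n⇒∃[o]m+o≡n |w|≤L
    ... | i′ , l′ , le , eq′ | r , refl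
      with trans (sym (length-factorAt i L)) (trans (cong length eq′) (length-factorAt i′ l′))
    ... | refl = i′ , length w , ≤-trans (+-monoʳ-≤ i′ (m≤m+n (length w) r)) le ,
      trans (sym eq) (factorAt-prefix i i′ (length w) r eq′)

  -- Complexities and the telescoping sum

  module _ {C P : ℕ → ℕ} (isC : IsFactorComplexity u C) (isP : IsPalComplexity u P) where

    palsUpTo : ℕ → ℕ
    palsUpTo zero    = P 0
    palsUpTo (suc n) = palsUpTo n + P (suc n)

    palsUpTo-card : ∀ n → IsCard (λ w → (InLang u w × IsPalindrome w) × length w ≤ n) (palsUpTo n)
    palsUpTo-card zero = card-resp (λ w ((lw , o) , p) → (o , p) , ≤-reflexive lw)
      (λ w ((o , p) , le) → (n≤0⇒n≡0 le , o) , p) (isP 0)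
    palsUpTo-card (suc n) = card-resp fwd bwd
      (card-⊎ (λ w (_ , le) ((lw , _) , _) → <⇒≱ (≤-reflexive (sym lw)) le) (palsUpTo-card n) (isP (suc n)))
      where
      fwd : ∀ w → _ ⊎ _ → _
      fwd w (inj₁ (p , le))       = p , m≤n⇒m≤1+n le
      fwd w (inj₂ ((lw , o) , p)) = (o , p) , ≤-reflexive lw
      bwd : ∀ w → _ → _ ⊎ _
      bwd w ((o , p) , le) with m≤n⇒m<n∨m≡n le
      ... | inj₁ lt = inj₁ ((o , p) , s≤s⁻¹ lt)
      ... | inj₂ lw = inj₂ ((lw , o) , p)

    card-empty-word : IsCard (λ (w : FWord k) → w ≡ []) 1
    card-empty-word = card-insert [] id refl (λ w ()) (λ w → inj₂) (card-empty λ w → id)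

    length≡0⇒[] : ∀ (w : FWord k) → length w ≡ 0 → w ≡ []
    length≡0⇒[] [] _ = refl

    C0≡1 : C 0 ≡ 1
    C0≡1 = card-unique (isC 0) card-empty-word (λ w → length≡0⇒[] w ∘ proj₁) λ { w refl → refl , 0 , refl }

    P0≡1 : P 0 ≡ 1
    P0≡1 = card-unique (isP 0) card-empty-word (λ w → length≡0⇒[] w ∘ proj₁ ∘ proj₁) λ { w refl → (refl , 0 , refl) , refl }

    -- Adding `2 P(n+1)` to `T n` gives the increment of `C n + P n + 2 n`, so the sum telescopes.
    -- At `n = 0` both sides are 2, on account of the empty word.
    sumBelow-T : ∀ n → + 2 * + palsUpTo n ℤ.+ sumBelow (T C P) n ≡ + C n ℤ.+ + P n ℤ.+ + 2 * + n
    sumBelow-T zero rewrite C0≡1 | P0≡1 = refl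
    sumBelow-T (suc n) = begin
      + 2 * (s ℤ.+ p′) ℤ.+ (t ℤ.+ T C P n)
        ≡⟨ split s p′ t c c′ p ⟩
      (+ 2 * s ℤ.+ t) ℤ.+ (c′ ℤ.- c ℤ.+ + 2 ℤ.+ p′ ℤ.- p)
        ≡⟨ cong (ℤ._+ (c′ ℤ.- c ℤ.+ + 2 ℤ.+ p′ ℤ.- p)) (sumBelow-T n) ⟩
      (c ℤ.+ p ℤ.+ + 2 * + n) ℤ.+ (c′ ℤ.- c ℤ.+ + 2 ℤ.+ p′ ℤ.- p)
        ≡⟨ telescope c c′ p p′ (+ n) ⟩
      c′ ℤ.+ p′ ℤ.+ + 2 * + suc n ∎
      where
      open ≡-Reasoning
      s t c c′ p p′ : ℤ
      s  = + palsUpTo n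
      t  = sumBelow (T C P) n
      c  = + C n
      c′ = + C (suc n)
      p  = + P n
      p′ = + P (suc n)
      split : ∀ s p′ t c c′ p → + 2 * (s ℤ.+ p′) ℤ.+ (t ℤ.+ (c′ ℤ.- c ℤ.+ + 2 ℤ.- p′ ℤ.- p))
        ≡ (+ 2 * s ℤ.+ t) ℤ.+ (c′ ℤ.- c ℤ.+ + 2 ℤ.+ p′ ℤ.- p)
      split = ℤ-Solver.solve-∀
      telescope : ∀ c c′ p p′ n → (c ℤ.+ p ℤ.+ + 2 * n) ℤ.+ (c′ ℤ.- c ℤ.+ + 2 ℤ.+ p′ ℤ.- p)
        ≡ c′ ℤ.+ p′ ℤ.+ + 2 * (+ 1 ℤ.+ n)
      telescope = ℤ-Solver.solve-∀

    -- On a prefix containing all factors of length at most `suc L′` the three counts of the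
    -- invariant become those of `u`. Closure of the language under reversal turns `ReversalClosure`
    -- into the set of factors of length `suc L′`.
    palsUpTo-count : ∀ {d L′} → ClosedUnderReversal u → (isDefect : IsDefect u d) → defect-attained isDefect ≤ L′ →
      2 ℕ.* palsUpTo (suc L′) ≡ C (suc L′) + P (suc L′) + 2 ℕ.* #pal L′
    palsUpTo-count {L′ = L′} closed isDefect n₀≤L′ with exhausting-prefix (isC (suc L′))
    -- The maximum keeps the prefix exhaustive and also long enough for the invariant, which starts
    -- at `L′`.
    ... | M₀ , exhausted with invariant isDefect n₀≤L′ {M₀ ⊔ L′} (≤⇒≤′ (m≤n⊔m M₀ L′))
    ... | a , b , e , ca , cb , ce , eq
      with card-unique ca (palsUpTo-card (suc L′)) (λ w ((o , p) , le) → (Occ⇒InLang o , p) , le)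
             (λ w ((o , p) , le) → (occurs le o , p) , le)
         | card-unique cb (isC (suc L′)) (λ { w (lw , inj₁ o) → lw , Occ⇒InLang o
                                            ; w (lw , inj₂ o) → lw , subst (InLang u) (reverse-involutive w) (closed _ (Occ⇒InLang o)) })
             (λ w (lw , o) → lw , inj₁ (occurs (≤-reflexive lw) o))
         | card-unique ce (isP (suc L′)) (λ w (lw , o , p) → (lw , Occ⇒InLang o) , p)
             (λ w ((lw , o) , p) → lw , occurs (≤-reflexive lw) o , p)
      where
      occurs : ∀ {w} → length w ≤ suc L′ → InLang u w → Occ (M₀ ⊔ L′) w
      occurs le o = Occ-mono (m≤m⊔n M₀ L′) (exhausted le o)
    ... | refl | refl | refl = eq

    -- Both `sumBelow-T` and `palsUpTo-count` evaluate twice the number of palindromes up to length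
    -- `suc L′`; replacing `suc L′` by `d + #pal L′` leaves `2 d` after cancellation.
    sumBelow-T≡2d : ∀ {d L′} → ClosedUnderReversal u → (isDefect : IsDefect u d) → defect-attained isDefect ≤ L′ →
      + 2 * d ≡ sumBelow (T C P) (suc L′)
    sumBelow-T≡2d {d} {L′} closed isDefect n₀≤L′ = sym (ℤ-+-cancelˡ (x ℤ.+ + 2 * q) _ _ (begin
      x ℤ.+ + 2 * q ℤ.+ t                        ≡⟨ cong (λ y → x ℤ.+ y ℤ.+ t) (ℤₚ.pos-* 2 (#pal L′)) ⟨
      + (C (suc L′) + P (suc L′) + 2 ℕ.* #pal L′) ℤ.+ t
                                                 ≡⟨ cong (λ n → + n ℤ.+ t) (palsUpTo-count closed isDefect n₀≤L′) ⟨
      + (2 ℕ.* palsUpTo (suc L′)) ℤ.+ t          ≡⟨ cong (ℤ._+ t) (ℤₚ.pos-* 2 (palsUpTo (suc L′))) ⟩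
      + 2 * + palsUpTo (suc L′) ℤ.+ t            ≡⟨ sumBelow-T (suc L′) ⟩
      x ℤ.+ + 2 * + suc L′                       ≡⟨ cong (λ y → x ℤ.+ + 2 * y) (#pal-defect isDefect (≤⇒≤′ n₀≤L′)) ⟨
      x ℤ.+ + 2 * (d ℤ.+ q)                      ≡⟨ regroup x d q ⟩
      x ℤ.+ + 2 * q ℤ.+ + 2 * d                  ∎))
      where
      open ≡-Reasoning
      x q t : ℤ
      x = + C (suc L′) ℤ.+ + P (suc L′)
      q = + #pal L′
      t = sumBelow (T C P) (suc L′)
      regroup : ∀ x d q → x ℤ.+ + 2 * (d ℤ.+ q) ≡ x ℤ.+ + 2 * q ℤ.+ + 2 * d
      regroup = ℤ-Solver.solve-∀

-- A convergent series of integers has only finitely many nonzero terms, so its sum is any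
-- sufficiently late partial sum.
sumBelow-stable : ∀ (f : ℕ → ℤ) {N} → (∀ n → n ≥ N → f n ≡ + 0) → ∀ {M} → N ≤′ M → sumBelow f M ≡ sumBelow f N
sumBelow-stable f vanish ≤′-refl = refl
sumBelow-stable f vanish {suc M} (≤′-step le) =
  trans (cong (λ x → sumBelow f M ℤ.+ x) (vanish M (≤′⇒≤ le)))
        (trans (ℤₚ.+-identityʳ _) (sumBelow-stable f vanish le))

theorem1 : (k : ℕ) (u : Word k) (C P : ℕ → ℕ) (d : ℤ) (N : ℕ)
    → ClosedUnderReversal u
    → IsFactorComplexity u C
    → IsPalComplexity u P
    → IsDefect u d
    → (∀ n → n ≥ N → T C P n ≡ + 0)
    → + 2 * d ≡ sumBelow (T C P) N
theorem1 k u C P d N closed isC isP isDefect vanish = trans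
  -- The partial sum is taken beyond both the length attaining the defect, where it equals `2 d`,
  -- and `N`, where it has become stationary.
  (sumBelow-T≡2d u isC isP closed isDefect (m≤m⊔n (defect-attained u isDefect) N))
  (sumBelow-stable (T C P) vanish (≤⇒≤′ (m≤n⇒m≤1+n (m≤n⊔m (defect-attained u isDefect) N))))
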